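{- Every sequent provable in the calculus $\mathsf{G4iSLt}+(\mathrm{cut})$ is provable in $\mathsf{G4iSLt}$; i.e. the additive cut rule is eliminable from $\mathsf{G4iSLt}+(\mathrm{cut})$.
   Context: Formulas are built by the grammar $\varphi ::= p \mid \bot \mid \varphi\land\varphi \mid \varphi\lor\varphi \mid \varphi\to\varphi \mid \Box\varphi$, with $p$ ranging over a countably infinite set of propositional variables. For a multiset $\Gamma$, $\Box\Gamma=\{\Box\psi:\psi\in\Gamma\}$; a boxed formula is one of the form $\Box\psi$. A sequent is $\Gamma\Rightarrow\chi$ with $\Gamma$ a finite multiset of formulas and $\chi$ a formula. The sequent calculus $\mathsf{G4iSLt}$ has the following rules, where $p$ is a propositional variable and $\Phi$ always denotes a multiset containing no boxed formula: (⊥L) $\bot,\Gamma\Rightarrow\chi$ (no premise); (IdP) $\Gamma,p\Rightarrow p$ (no premise); (∧L) from $\Gamma,\varphi,\psi\Rightarrow\chi$ infer $\Gamma,\varphi\land\psi\Rightarrow\chi$; (∧R) from $\Gamma\Rightarrow\varphi$ and $\Gamma\Rightarrow\psi$ infer $\Gamma\Rightarrow\varphi\land\psi$; (∨L) from $\Gamma,\varphi\Rightarrow\chi$ and $\Gamma,\psi\Rightarrow\chi$ infer $\Gamma,\varphi\lor\psi\Rightarrow\chi$; (∨R$_i$), $i\in\{1,2\}$: from $\Gamma\Rightarrow\varphi_i$ infer $\Gamma\Rightarrow\varphi_1\lor\varphi_2$; (p→L) from $\Gamma,p,\varphi\Rightarrow\chi$ infer $\Gamma,p,p\to\varphi\Rightarrow\chi$;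 (→R) from $\Gamma,\varphi\Rightarrow\psi$ infer $\Gamma\Rightarrow\varphi\to\psi$; (□→L) from $\Phi,\Gamma,\psi,\Box\varphi\Rightarrow\varphi$ and $\Phi,\Box\Gamma,\psi\Rightarrow\chi$ infer $\Phi,\Box\Gamma,\Box\varphi\to\psi\Rightarrow\chi$; (SLtR) from $\Phi,\Gamma,\Box\varphi\Rightarrow\varphi$ infer $\Phi,\Box\Gamma\Rightarrow\Box\varphi$; (∧→L) from $\Gamma,\varphi\to(\psi\to\chi)\Rightarrow\delta$ infer $\Gamma,(\varphi\land\psi)\to\chi\Rightarrow\delta$; (∨→L) from $\Gamma,\varphi\to\chi,\psi\to\chi\Rightarrow\delta$ infer $\Gamma,(\varphi\lor\psi)\to\chi\Rightarrow\delta$; (→→L) from $\Gamma,\psi\to\chi\Rightarrow\varphi\to\psi$ and $\Gamma,\chi\Rightarrow\delta$ infer $\Gamma,(\varphi\to\psi)\to\chi\Rightarrow\delta$. A proof of a sequent $S$ is a finite tree of sequents with root $S$ in which each interior node together with its children forms an instance of a rule (conclusion, premises) and each leaf is the conclusion of a premise-free rule; $S$ is provable if it has a proof. The calculus $\mathsf{G4iSLt}+(\mathrm{cut})$ consists of all rules of $\mathsf{G4iSLt}$ together with the additive cut rule: from $\Gamma\Rightarrow\varphi$ and $\varphi,\Gamma\Rightarrow\chi$ infer $\Gamma\Rightarrow\chi$ (for arbitrary finite multiset $\Gamma$ and formulas $\varphi,\chi$). -}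

module Defs where

open import Data.List.Base using (List; []; _∷_; _++_; map)
open import Data.List.Relation.Binary.Permutation.Propositional using (_↭_)
open import Data.List.Relation.Unary.All using (All)
open import Data.Nat.Base using (ℕ)
open import Level using (0ℓ)
open import Relation.Binary.Construct.Union using (_∪_)
open import Relation.Binary.Core using (REL)
open import Relation.Binary.PropositionalEquality.Core using (_≡_)
open import Relation.Nullary.Negation.Core using (¬_)

infixr 30 □_
infixr 25 _∧_
infixr 24 _∨_
infixr 23 _⟶_
infix  4  _⇒_ _≈ₛ_
infix  3  _⊢_

data Formula : Set where
  var         : (p : ℕ) → Formula
  ⊥           : Formula
  _∧_ _∨_ _⟶_ : (φ ψ : Formula) → Formula
  □_          : (φ : Formula) → Formula

data Boxed : Formula → Set where
  boxed : ∀ ψ → Boxed (□ ψ)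

-- Finite multisets are represented by lists, to be identified when they are
-- permutations of one another (see _≈ₛ_ and its use in _⊢_).
Context : Set
Context = List Formula

□* : Context → Context
□* = map □_

NoBoxed : Context → Set
NoBoxed = All (λ φ → ¬ Boxed φ)

record Sequent : Set where
  constructor _⇒_
  field
    antecedent : Context
    succedent  : Formula

record _≈ₛ_ (S T : Sequent) : Set where
  constructor mk≈
  private
    module S = Sequent S
    module T = Sequent T
  field
    antecedent-↭ : S.antecedent ↭ T.antecedent
    succedent-≡  : S.succedent ≡ T.succedent

-- A set of rules relates the list of premises of each instance to its
-- conclusion, in terms of list representatives of the multisets.
Rules : Set₁
Rules = REL (List Sequent) Sequent 0ℓ

data G4iSLt : Rules where

  ⊥L : ∀ {Γ χ} →
       G4iSLt [] (⊥ ∷ Γ ⇒ χ)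

  IdP : ∀ {Γ p} →
        G4iSLt [] (var p ∷ Γ ⇒ var p)

  ∧L : ∀ {Γ φ ψ χ} →
       G4iSLt ((φ ∷ ψ ∷ Γ ⇒ χ) ∷ [])
              (φ ∧ ψ ∷ Γ ⇒ χ)

  ∧R : ∀ {Γ φ ψ} →
       G4iSLt ((Γ ⇒ φ) ∷ (Γ ⇒ ψ) ∷ [])
              (Γ ⇒ φ ∧ ψ)

  ∨L : ∀ {Γ φ ψ χ} →
       G4iSLt ((φ ∷ Γ ⇒ χ) ∷ (ψ ∷ Γ ⇒ χ) ∷ [])
              (φ ∨ ψ ∷ Γ ⇒ χ)

  ∨R₁ : ∀ {Γ φ₁ φ₂} →
        G4iSLt ((Γ ⇒ φ₁) ∷ [])
               (Γ ⇒ φ₁ ∨ φ₂)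

  ∨R₂ : ∀ {Γ φ₁ φ₂} →
        G4iSLt ((Γ ⇒ φ₂) ∷ [])
               (Γ ⇒ φ₁ ∨ φ₂)

  p→L : ∀ {Γ p φ χ} →
        G4iSLt ((var p ∷ φ ∷ Γ ⇒ χ) ∷ [])
               (var p ∷ (var p ⟶ φ) ∷ Γ ⇒ χ)

  →R : ∀ {Γ φ ψ} →
       G4iSLt ((φ ∷ Γ ⇒ ψ) ∷ [])
              (Γ ⇒ φ ⟶ ψ)

  □→L : ∀ {Φ Γ φ ψ χ} → NoBoxed Φ →
        G4iSLt ((□ φ ∷ ψ ∷ Φ ++ Γ ⇒ φ) ∷ (ψ ∷ Φ ++ □* Γ ⇒ χ) ∷ [])
               ((□ φ ⟶ ψ) ∷ Φ ++ □* Γ ⇒ χ)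

  SLtR : ∀ {Φ Γ φ} → NoBoxed Φ →
         G4iSLt ((□ φ ∷ Φ ++ Γ ⇒ φ) ∷ [])
                (Φ ++ □* Γ ⇒ □ φ)

  ∧→L : ∀ {Γ φ ψ χ δ} →
        G4iSLt (((φ ⟶ (ψ ⟶ χ)) ∷ Γ ⇒ δ) ∷ [])
               (((φ ∧ ψ) ⟶ χ) ∷ Γ ⇒ δ)

  ∨→L : ∀ {Γ φ ψ χ δ} →
        G4iSLt (((φ ⟶ χ) ∷ (ψ ⟶ χ) ∷ Γ ⇒ δ) ∷ [])
               (((φ ∨ ψ) ⟶ χ) ∷ Γ ⇒ δ)

  →→L : ∀ {Γ φ ψ χ δ} →
        G4iSLt (((ψ ⟶ χ) ∷ Γ ⇒ φ ⟶ ψ) ∷ (χ ∷ Γ ⇒ δ) ∷ [])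
               (((φ ⟶ ψ) ⟶ χ) ∷ Γ ⇒ δ)

data Cut : Rules where
  cut : ∀ {Γ φ χ} →
        Cut ((Γ ⇒ φ) ∷ (φ ∷ Γ ⇒ χ) ∷ [])
            (Γ ⇒ χ)

G4iSLt+cut : Rules
G4iSLt+cut = G4iSLt ∪ Cut

-- Proofs of S as finite trees; a leaf is a node whose rule instance has no
-- premises.  The first argument of node makes each rule apply to multisets:
-- the conclusion matches up to permutation, and hence so do the premises,
-- each being in turn the conclusion of a node.
data _⊢_ (R : Rules) : Sequent → Set where
  node : ∀ {Ss S T} → T ≈ₛ S → R Ss S → All (R ⊢_) Ss → R ⊢ T

{-# OPTIONS --safe #-}

-- The proof is semantic.  Over finite trees whose edges are either plain or
-- modal, every rule of G4iSLt+cut is sound: → quantifies over all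
-- descendants, □ over those reached through a modal edge, and the Löb step is
-- an induction on the tree.  Conversely, terminating backward proof search in
-- G4iSLt decides each sequent: either it is provable, or some rule has an
-- unprovable premise whose countermodel already refutes the sequent, or the
-- countermodels of all unprovable premises, grafted below a new root, do.  A
-- sequent provable with cut has no countermodel, so the search proves it.
module Submission where

open import Defs

open import Data.Empty as Empty using (⊥-elim)
open import Data.List.Base using (List; []; _∷_; _++_; map; length)
open import Data.List.Membership.Propositional using (_∈_)
open import Data.List.Membership.Propositional.Properties using (∈-∃++)
open import Data.List.Properties using (length-map)
open import Data.List.Relation.Binary.Permutation.Propositional
  using (_↭_; prep; swap; ↭-refl; ↭-sym; ↭-trans; ↭-reflexive)
open import Data.List.Relation.Binary.Permutation.Propositional.Properties
  using (All-resp-↭; ∈-resp-↭; map⁺; shift)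
open import Data.List.Relation.Binary.Subset.Propositional using (_⊆_)
open import Data.List.Relation.Binary.Subset.Propositional.Properties
  using (⊆-refl; xs⊆xs++ys; xs⊆ys++xs)
open import Data.List.Relation.Unary.All as All using (All; []; _∷_)
import Data.List.Relation.Unary.All.Properties as AllP
open import Data.List.Relation.Unary.Any using (here; there; any?)
open import Data.Nat.Base
open import Data.Nat.Induction using (<-wellFounded)
open import Data.Nat.ListAction using (sum)
open import Data.Nat.ListAction.Properties using (sum-↭)
open import Data.Nat.Properties
open import Data.Product using (∃; _×_; _,_; proj₁; proj₂)
open import Data.Sum using (_⊎_; inj₁; inj₂)
open import Function.Base using (_∘_; flip)
open import Induction.WellFounded as WF using (Acc; acc; WellFounded)
open import Level using (0ℓ)
import Relation.Binary.Construct.On as On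
open import Relation.Binary.PropositionalEquality
  using (_≡_; refl; sym; trans; cong; subst)
open import Relation.Nullary using (Dec; yes; no; ¬_)
open import Relation.Nullary.Decidable using (map′)

-- Tree models

data Edge : Set where
  plain modal : Edge

data Tree : Set where
  node : Context → List (Edge × Tree) → Tree

label : Tree → Context
label (node Γ _) = Γ

infix 4 _≼_ _◁_ _⊩_ _⊩*_

data _≼_ : Tree → Tree → Set where
  root  : ∀ {T} → T ≼ T
  below : ∀ {Γ cs e c T} → (e , c) ∈ cs → c ≼ T → node Γ cs ≼ T

-- A path crossing at least one modal edge. Being contained in `≼`, it validates the strong Löb law
-- `φ ⟶ □ φ`.
data _◁_ : Tree → Tree → Set where
  modal : ∀ {Γ cs c T} → (modal , c) ∈ cs → c ≼ T → node Γ cs ◁ T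
  below : ∀ {Γ cs e c T} → (e , c) ∈ cs → c ◁ T → node Γ cs ◁ T

≼-trans : ∀ {S T U} → S ≼ T → T ≼ U → S ≼ U
≼-trans root          T≼U = T≼U
≼-trans (below i c≼T) T≼U = below i (≼-trans c≼T T≼U)

◁⇒≼ : ∀ {S T} → S ◁ T → S ≼ T
◁⇒≼ (modal i c≼T) = below i c≼T
◁⇒≼ (below i c◁T) = below i (◁⇒≼ c◁T)

≼-◁-trans : ∀ {S T U} → S ≼ T → T ◁ U → S ◁ U
≼-◁-trans root          T◁U = T◁U
≼-◁-trans (below i c≼T) T◁U = below i (≼-◁-trans c≼T T◁U)

◁-trans : ∀ {S T U} → S ◁ T → T ◁ U → S ◁ U
◁-trans = ≼-◁-trans ∘ ◁⇒≼

Acc-≼ : ∀ {S T} → S ≼ T → Acc (flip _◁_) S → Acc (flip _◁_) T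
Acc-≼ S≼T (acc rs) = acc (rs ∘ ≼-◁-trans S≼T)

-- Trees are finite: every `◁`-successor lies at or below a child, and accessibility passes down
-- along `≼`.
◁-conversely-wellFounded : WellFounded (flip _◁_)
children-accessible : ∀ cs → All (Acc (flip _◁_) ∘ proj₂) cs

◁-conversely-wellFounded (node Γ cs) = acc λ where
  (modal i c≼T) → Acc-≼ c≼T (All.lookup (children-accessible cs) i)
  (below i c◁T) → Acc-≼ (◁⇒≼ c◁T) (All.lookup (children-accessible cs) i)

children-accessible []             = []
children-accessible ((_ , c) ∷ cs) =
  ◁-conversely-wellFounded c ∷ children-accessible cs

-- Labels need not grow along the tree, so a variable is forced when it labels
-- all descendants.
_⊩_ : Tree → Formula → Set
T ⊩ var p   = ∀ {U} → T ≼ U → var p ∈ label U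
T ⊩ ⊥       = Empty.⊥
T ⊩ φ ∧ ψ   = T ⊩ φ × T ⊩ ψ
T ⊩ φ ∨ ψ   = T ⊩ φ ⊎ T ⊩ ψ
T ⊩ (φ ⟶ ψ) = ∀ {U} → T ≼ U → U ⊩ φ → U ⊩ ψ
T ⊩ □ φ     = ∀ {U} → T ◁ U → U ⊩ φ

_⊩*_ : Tree → Context → Set
T ⊩* Γ = All (T ⊩_) Γ

⊩-mono : ∀ φ {T U} → T ≼ U → T ⊩ φ → U ⊩ φ
⊩-mono (var p) T≼U f        = f ∘ ≼-trans T≼U
⊩-mono (φ ∧ ψ) T≼U (f , g)  = ⊩-mono φ T≼U f , ⊩-mono ψ T≼U g
⊩-mono (φ ∨ ψ) T≼U (inj₁ f) = inj₁ (⊩-mono φ T≼U f)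
⊩-mono (φ ∨ ψ) T≼U (inj₂ g) = inj₂ (⊩-mono ψ T≼U g)
⊩-mono (φ ⟶ ψ) T≼U f        = λ U≼V → f (≼-trans T≼U U≼V)
⊩-mono (□ φ)   T≼U f        = λ U◁V → f (≼-◁-trans T≼U U◁V)

⊩*-mono : ∀ {Γ T U} → T ≼ U → T ⊩* Γ → U ⊩* Γ
⊩*-mono T≼U = All.map λ {φ} → ⊩-mono φ T≼U

⊩-□ : ∀ φ {T} → T ⊩ φ → T ⊩ □ φ
⊩-□ φ f T◁U = ⊩-mono φ (◁⇒≼ T◁U) f

⊩-const : ∀ φ {ψ T} → T ⊩ ψ → T ⊩ (φ ⟶ ψ)
⊩-const φ {ψ} f T≼U _ = ⊩-mono ψ T≼U f

⊩-□*⁻ : ∀ Γ {T U} → T ◁ U → T ⊩* □* Γ → U ⊩* Γ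
⊩-□*⁻ Γ T◁U = All.map (λ f → f T◁U) ∘ AllP.map⁻

-- Induction along converse `◁`; by transitivity the hypothesis about `T` stays available at all
-- later modal successors.
⊩-Löb : ∀ φ {T} → (∀ {U} → T ◁ U → U ⊩ □ φ → U ⊩ φ) → T ⊩ □ φ
⊩-Löb φ {T} h {U} T◁U = go (◁-conversely-wellFounded U) T◁U
  where
  go : ∀ {U} → Acc (flip _◁_) U → T ◁ U → U ⊩ φ
  go (acc rs) T◁U = h T◁U λ U◁V → go (rs U◁V) (◁-trans T◁U U◁V)

-- The semantic counterpart of a modal premise: `◁` opens the boxes of `□* Γ`, while `Φ` merely
-- persists.
⊩-descend : ∀ Φ Γ {T U} → T ◁ U → T ⊩* (Φ ++ □* Γ) → U ⊩* (Φ ++ Γ)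
⊩-descend Φ Γ T◁U fs =
  AllP.++⁺ (⊩*-mono (◁⇒≼ T◁U) (AllP.++⁻ˡ Φ fs))
           (⊩-□*⁻ Γ T◁U (AllP.++⁻ʳ Φ fs))

-- Soundness of the calculus with cut

soundness : ∀ {Γ χ T} → G4iSLt+cut ⊢ Γ ⇒ χ → T ⊩* Γ → T ⊩ χ
rule-sound : ∀ {Ss Γ χ T} → G4iSLt+cut Ss (Γ ⇒ χ) →
             All (G4iSLt+cut ⊢_) Ss → T ⊩* Γ → T ⊩ χ

soundness (node (mk≈ p refl) r ds) fs = rule-sound r ds (All-resp-↭ p fs)

rule-sound (inj₁ ⊥L)  _ (f ∷ _) = ⊥-elim f
rule-sound (inj₁ IdP) _ (f ∷ _) = f
rule-sound (inj₁ ∧L)  (d ∷ []) ((f , g) ∷ fs) = soundness d (f ∷ g ∷ fs)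
rule-sound (inj₁ ∧R)  (d ∷ e ∷ []) fs = soundness d fs , soundness e fs
rule-sound (inj₁ ∨L)  (d ∷ e ∷ []) (inj₁ f ∷ fs) = soundness d (f ∷ fs)
rule-sound (inj₁ ∨L)  (d ∷ e ∷ []) (inj₂ g ∷ fs) = soundness e (g ∷ fs)
rule-sound (inj₁ ∨R₁) (d ∷ []) fs = inj₁ (soundness d fs)
rule-sound (inj₁ ∨R₂) (d ∷ []) fs = inj₂ (soundness d fs)
rule-sound (inj₁ p→L) (d ∷ []) (f ∷ g ∷ fs) = soundness d (f ∷ g root f ∷ fs)
rule-sound (inj₁ →R)  (d ∷ []) fs =
  λ T≼U f → soundness d (f ∷ ⊩*-mono T≼U fs)
rule-sound (inj₁ (□→L {Φ} {Γ} {φ} _)) (d ∷ e ∷ []) (f ∷ fs) =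
  soundness e (g ∷ fs)
  where
  -- At a modal successor forcing `□ φ`, the implication yields `ψ`, so the first premise gives `φ`;
  -- Löb then gives `□ φ` at the root.
  g = f root (⊩-Löb φ λ T◁U h →
        soundness d (h ∷ f (◁⇒≼ T◁U) h ∷ ⊩-descend Φ Γ T◁U fs))
rule-sound (inj₁ (SLtR {Φ} {Γ} {φ} _)) (d ∷ []) fs =
  ⊩-Löb φ λ T◁U h → soundness d (h ∷ ⊩-descend Φ Γ T◁U fs)
rule-sound (inj₁ (∧→L {φ = φ})) (d ∷ []) (f ∷ fs) =
  soundness d ((λ T≼U a U≼V b → f (≼-trans T≼U U≼V) (⊩-mono φ U≼V a , b)) ∷ fs)
rule-sound (inj₁ ∨→L) (d ∷ []) (f ∷ fs) =
  soundness d ((λ T≼U → f T≼U ∘ inj₁) ∷ (λ T≼U → f T≼U ∘ inj₂) ∷ fs)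
rule-sound (inj₁ (→→L {φ = φ})) (d ∷ e ∷ []) (f ∷ fs) =
  -- `ψ` makes `φ ⟶ ψ` true, so the principal formula entails `ψ ⟶ χ`.
  soundness e (f root (soundness d ((λ T≼U b → f T≼U (⊩-const φ b)) ∷ fs)) ∷ fs)
rule-sound (inj₂ cut) (d ∷ e ∷ []) fs = soundness e (soundness d fs ∷ fs)

-- Derived rules

-- Splitting a context as `Φ ++ □* Γ` is unique up to order, so the part `Φ ++ Γ` of a modal premise
-- is the image of the context under this map.
unbox : Formula → Formula
unbox (□ φ) = φ
unbox φ     = φ

unbox* : Context → Context
unbox* = map unbox

Provable : Sequent → Set
Provable S = G4iSLt ⊢ S

⊢-resp-↭ : ∀ {R Γ Δ χ} → Γ ↭ Δ → R ⊢ (Γ ⇒ χ) → R ⊢ (Δ ⇒ χ)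
⊢-resp-↭ Γ↭Δ (node (mk≈ p eq) r ds) = node (mk≈ (↭-trans (↭-sym Γ↭Δ) p) eq) r ds

infer : ∀ {Ss S} → G4iSLt Ss S → All Provable Ss → Provable S
infer = node (mk≈ ↭-refl refl)

-- The equation is stored because the catch-all clause of `unbox` does not reduce on an unknown
-- formula.
data BoxView : Formula → Set where
  box    : ∀ φ → BoxView (□ φ)
  nonBox : ∀ {φ} → ¬ Boxed φ → unbox φ ≡ φ → BoxView φ

boxView : ∀ φ → BoxView φ
boxView (var p) = nonBox (λ ()) refl
boxView ⊥       = nonBox (λ ()) refl
boxView (φ ∧ ψ) = nonBox (λ ()) refl
boxView (φ ∨ ψ) = nonBox (λ ()) refl
boxView (φ ⟶ ψ) = nonBox (λ ()) refl
boxView (□ φ)   = box φ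

record BoxSplit (Γ : Context) : Set where
  constructor mkSplit
  field
    {Φ Δ}   : Context
    noBoxed : NoBoxed Φ
    boxes   : Γ ↭ Φ ++ □* Δ
    unboxes : unbox* Γ ↭ Φ ++ Δ

boxSplit : ∀ Γ → BoxSplit Γ
boxSplit []      = mkSplit [] ↭-refl ↭-refl
boxSplit (φ ∷ Γ) with boxView φ | boxSplit Γ
... | box ψ | mkSplit {Φ} {Δ} nb b u =
  mkSplit {Δ = ψ ∷ Δ} nb
    (↭-trans (prep _ b) (↭-sym (shift (□ ψ) Φ (□* Δ))))
    (↭-trans (prep _ u) (↭-sym (shift ψ Φ Δ)))
... | nonBox ¬b eq | mkSplit nb b u =
  mkSplit (¬b ∷ nb) (prep _ b) (↭-trans (↭-reflexive (cong (_∷ _) eq)) (prep _ u))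

SLtR-unbox : ∀ {Γ φ} → Provable (□ φ ∷ unbox* Γ ⇒ φ) → Provable (Γ ⇒ □ φ)
SLtR-unbox {Γ} d = ⊢-resp-↭ (↭-sym boxes)
  (infer (SLtR noBoxed) (⊢-resp-↭ (prep _ unboxes) d ∷ []))
  where open BoxSplit (boxSplit Γ)

□→L-unbox : ∀ {Γ φ ψ χ} → Provable (□ φ ∷ ψ ∷ unbox* Γ ⇒ φ) →
            Provable (ψ ∷ Γ ⇒ χ) → Provable ((□ φ ⟶ ψ) ∷ Γ ⇒ χ)
□→L-unbox {Γ} d e = ⊢-resp-↭ (prep _ (↭-sym boxes))
  (infer (□→L noBoxed)
    (⊢-resp-↭ (prep _ (prep _ unboxes)) d ∷ ⊢-resp-↭ (prep _ boxes) e ∷ []))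
  where open BoxSplit (boxSplit Γ)

∈⇒↭ : ∀ {φ : Formula} {Γ} → φ ∈ Γ → ∃ λ Δ → Γ ↭ φ ∷ Δ
∈⇒↭ φ∈Γ with Δ , Θ , refl ← ∈-∃++ φ∈Γ = Δ ++ Θ , shift _ Δ Θ

-- Termination of proof search

-- The 2 for conjunction makes `φ ⟶ (ψ ⟶ χ)` lighter than `(φ ∧ ψ) ⟶ χ`; with 1 they would tie.
weight : Formula → ℕ
weight (var p) = 1
weight ⊥       = 1
weight (φ ∧ ψ) = 2 + (weight φ + weight ψ)
weight (φ ∨ ψ) = 1 + (weight φ + weight ψ)
weight (φ ⟶ ψ) = 1 + (weight φ + weight ψ)
weight (□ φ)   = 1 + weight φ

cost : Formula → ℕ
cost φ = 4 ^ weight φ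

total : Context → ℕ
total Γ = sum (map cost Γ)

-- Boxes are stripped in the antecedent, so that SLtR decreases the measure
-- although it copies □ φ to the left.  Each premise replaces some formulas by
-- at most three lighter ones, whence the base 4.
measure : Sequent → ℕ
measure (Γ ⇒ χ) = total (unbox* Γ) + cost χ

weight-unbox : ∀ φ → weight (unbox φ) ≤ weight φ
weight-unbox (var p) = ≤-refl
weight-unbox ⊥       = ≤-refl
weight-unbox (φ ∧ ψ) = ≤-refl
weight-unbox (φ ∨ ψ) = ≤-refl
weight-unbox (φ ⟶ ψ) = ≤-refl
weight-unbox (□ φ)   = n≤1+n _

-- Meant for contexts already unboxed: measuring a modal premise strips a second layer of boxes.
total-unbox : ∀ Γ → total (unbox* Γ) ≤ total Γ
total-unbox []      = z≤n
total-unbox (φ ∷ Γ) = +-mono-≤ (^-monoʳ-≤ 4 (weight-unbox φ)) (total-unbox Γ)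

Lighter : ℕ → Formula → Set
Lighter n φ = weight (unbox φ) < n

lighter : ∀ {n} φ → weight φ < n → Lighter n φ
lighter φ = ≤-<-trans (weight-unbox φ)

-- Multiset descent as arithmetic: three formulas of weight at most `n` cost at most `3 * 4 ^ n`,
-- which is below `4 ^ suc n`.
total-< : ∀ {n} Γ → length Γ ≤ 3 → All (λ φ → weight φ < n) Γ → total Γ < 4 ^ n
total-< {zero}  []      _  _  = s≤s z≤n
total-< {zero}  (_ ∷ _) _  (() ∷ _)
total-< {suc n} Γ       l≤3 ls = begin-strict
  total Γ           ≤⟨ bound Γ ls ⟩
  length Γ * 4 ^ n  ≤⟨ *-monoˡ-≤ (4 ^ n) l≤3 ⟩
  3 * 4 ^ n         <⟨ *-monoˡ-< (4 ^ n) {{m^n≢0 4 n}} {3} {4} ≤-refl ⟩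
  4 * 4 ^ n         ∎
  where
  open ≤-Reasoning
  bound : ∀ Γ → All (λ φ → weight φ < suc n) Γ → total Γ ≤ length Γ * 4 ^ n
  bound []      []             = z≤n
  bound (φ ∷ Γ) (s≤s φ≤n ∷ ls) = +-mono-≤ (^-monoʳ-≤ 4 φ≤n) (bound Γ ls)

total-unbox-++ : ∀ Γ Δ → total (unbox* (Γ ++ Δ)) ≡ total (unbox* Γ) + total (unbox* Δ)
total-unbox-++ []      Δ = refl
total-unbox-++ (φ ∷ Γ) Δ =
  trans (cong (cost (unbox φ) +_) (total-unbox-++ Γ Δ)) (sym (+-assoc (cost (unbox φ)) _ _))

infix 4 _≺_

-- A record keeps both sequents visible to unification, which a bare inequality of numbers would
-- not.
record _≺_ (S T : Sequent) : Set where
  constructor mk≺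
  field
    measure-< : measure S < measure T

open _≺_

≺-wellFounded : WellFounded _≺_
≺-wellFounded =
  WF.Subrelation.wellFounded measure-< (On.wellFounded measure <-wellFounded)

≺-left : ∀ x {Γ χ} Δ → length Δ ≤ 3 → All (Lighter (weight (unbox x))) Δ →
         (Δ ++ Γ ⇒ χ) ≺ (x ∷ Γ ⇒ χ)
≺-left x {Γ} {χ} Δ l≤3 ls = mk≺ (+-monoˡ-< (cost χ) (begin-strict
  total (unbox* (Δ ++ Γ))
    ≡⟨ total-unbox-++ Δ Γ ⟩
  total (unbox* Δ) + total (unbox* Γ)
    <⟨ +-monoˡ-< _ (total-< (unbox* Δ)
         (subst (_≤ 3) (sym (length-map unbox Δ)) l≤3) (AllP.map⁺ ls)) ⟩
  cost (unbox x) + total (unbox* Γ)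
    ∎))
  where open ≤-Reasoning

-- The cost of `χ` pays for `Θ` and the new succedent together, hence the bound 2 on `Θ`.
≺-right : ∀ χ {ψ Γ Δ} Θ → length Θ ≤ 2 → total (unbox* Δ) ≤ total (unbox* Γ) →
          weight ψ < weight χ → All (Lighter (weight χ)) Θ →
          (Θ ++ Δ ⇒ ψ) ≺ (Γ ⇒ χ)
≺-right χ {ψ} {Γ} {Δ} Θ l≤2 Δ≤Γ l ls = mk≺ (begin-strict
  total (unbox* (Θ ++ Δ)) + cost ψ
    ≡⟨ cong (_+ cost ψ) (total-unbox-++ Θ Δ) ⟩
  total (unbox* Θ) + total (unbox* Δ) + cost ψ
    ≤⟨ +-monoˡ-≤ (cost ψ) (+-monoʳ-≤ (total (unbox* Θ)) Δ≤Γ) ⟩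
  total (unbox* Θ) + total (unbox* Γ) + cost ψ
    ≡⟨ cong (_+ cost ψ) (+-comm (total (unbox* Θ)) _) ⟩
  total (unbox* Γ) + total (unbox* Θ) + cost ψ
    ≡⟨ +-assoc (total (unbox* Γ)) _ _ ⟩
  total (unbox* Γ) + (total (unbox* Θ) + cost ψ)
    ≡⟨ cong (total (unbox* Γ) +_) (+-comm (total (unbox* Θ)) _) ⟩
  total (unbox* Γ) + total (ψ ∷ unbox* Θ)
    <⟨ +-monoʳ-< (total (unbox* Γ))
         (total-< (ψ ∷ unbox* Θ)
           (s≤s (subst (_≤ 2) (sym (length-map unbox Θ)) l≤2))
           (l ∷ AllP.map⁺ ls)) ⟩
  total (unbox* Γ) + cost χ
    ∎)
  where open ≤-Reasoning

-- Here the left formula `x` pays for `Θ` and the new succedent, while `χ` is dropped; this is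
-- `≺-right` with `unbox x` in the role of succedent.
≺-both : ∀ x {ψ χ Γ Δ} Θ → length Θ ≤ 2 → total (unbox* Δ) ≤ total (unbox* Γ) →
         weight ψ < weight (unbox x) → All (Lighter (weight (unbox x))) Θ →
         (Θ ++ Δ ⇒ ψ) ≺ (x ∷ Γ ⇒ χ)
≺-both x {ψ} {χ} {Γ} Θ l≤2 Δ≤Γ l ls =
  mk≺ (<-≤-trans (measure-< (≺-right (unbox x) {ψ} {Γ} Θ l≤2 Δ≤Γ l ls))
    (≤-trans (≤-reflexive (+-comm (total (unbox* Γ)) (cost (unbox x))))
      (m≤m+n _ (cost χ))))

-- Proof search

Refuted : Sequent → Set
Refuted (Γ ⇒ χ) = ∃ λ T → T ⊩* Γ × ¬ T ⊩ χ

Decided : Sequent → Set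
Decided S = Provable S ⊎ Refuted S

-- What a tree must force to be grafted below a root meant to force `Γ`; across a modal edge the
-- boxes of `Γ` must be opened.
Suitable : Context → Edge × Tree → Set
Suitable Γ (plain , T) = T ⊩* Γ
Suitable Γ (modal , T) = T ⊩* unbox* Γ

⊩-unbox : ∀ φ {T} → T ⊩ unbox φ → T ⊩ φ
⊩-unbox φ f with boxView φ
... | box ψ       = ⊩-□ ψ f
... | nonBox _ eq = subst (_ ⊩_) eq f

suitable⇒⊩* : ∀ {Γ} c → Suitable Γ c → proj₂ c ⊩* Γ
suitable⇒⊩* (plain , T) fs = fs
suitable⇒⊩* (modal , T) fs = All.map (λ {φ} → ⊩-unbox φ) (AllP.map⁻ fs)

suitable-resp-↭ : ∀ {Γ Δ} → Γ ↭ Δ → ∀ {c} → Suitable Γ c → Suitable Δ c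
suitable-resp-↭ Γ↭Δ {plain , T} = All-resp-↭ Γ↭Δ
suitable-resp-↭ Γ↭Δ {modal , T} = All-resp-↭ (map⁺ unbox Γ↭Δ)

-- The quantification over further children lets one common root meet the
-- requirements of all formulas of a sequent.
record Ensured (Γ : Context) (P : Tree → Set) : Set where
  constructor ensure
  field
    children : List (Edge × Tree)
    suitable : All (Suitable Γ) children
    holds    : ∀ {Δ cs} → Γ ↭ Δ → children ⊆ cs → All (Suitable Γ) cs →
               P (node Δ cs)

ensured-resp-↭ : ∀ {Γ Δ P} → Γ ↭ Δ → Ensured Γ P → Ensured Δ P
ensured-resp-↭ Γ↭Δ (ensure cs ss h) =
  ensure cs (All.map (λ {c} → suitable-resp-↭ Γ↭Δ {c}) ss)
    λ Δ↭Θ ⊆ts ts → h (↭-trans Γ↭Δ Δ↭Θ) ⊆ts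
      (All.map (λ {c} → suitable-resp-↭ (↭-sym Γ↭Δ) {c}) ts)

ensured-× : ∀ {Γ P Q} → Ensured Γ P → Ensured Γ Q → Ensured Γ (λ T → P T × Q T)
ensured-× (ensure cs ss h) (ensure ds ts k) =
  ensure (cs ++ ds) (AllP.++⁺ ss ts) λ Γ↭Δ ⊆es es →
    h Γ↭Δ (⊆es ∘ xs⊆xs++ys cs ds) es , k Γ↭Δ (⊆es ∘ xs⊆ys++xs ds cs) es

ensured-⊩* : ∀ {Γ Δ} → All (λ φ → Ensured Γ (_⊩ φ)) Δ → Ensured Γ (_⊩* Δ)
ensured-⊩* []       = ensure [] [] λ _ _ _ → []
ensured-⊩* (e ∷ es) with ensure cs ss h ← ensured-× e (ensured-⊩* es) =
  ensure cs ss λ Γ↭Δ ⊆ts ts → let f , fs = h Γ↭Δ ⊆ts ts in f ∷ fs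

ensured⇒refuted : ∀ {Γ χ} → Ensured Γ (_⊩* Γ) → Ensured Γ (λ T → ¬ T ⊩ χ) →
                  Refuted (Γ ⇒ χ)
ensured⇒refuted {Γ} e e′ with ensure cs ss h ← ensured-× e e′ =
  node Γ cs , h ↭-refl ⊆-refl ss

⊩-⟶-root : ∀ {Γ cs φ ψ} → (node Γ cs ⊩ φ → node Γ cs ⊩ ψ) →
           All (λ c → proj₂ c ⊩ (φ ⟶ ψ)) cs → node Γ cs ⊩ (φ ⟶ ψ)
⊩-⟶-root f fs root          = f
⊩-⟶-root f fs (below i c≼U) = All.lookup fs i c≼U

suitable-head : ∀ {φ Γ cs} → All (Suitable (φ ∷ Γ)) cs → All (λ c → proj₂ c ⊩ φ) cs
suitable-head = All.map λ {c} → All.head ∘ suitable⇒⊩* c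

-- Suitable children force the implication already, so only the root matters, and there it holds
-- vacuously once `φ` fails.
ensured-⟶ : ∀ {φ ψ Γ} cs → All (Suitable ((φ ⟶ ψ) ∷ Γ)) cs →
            (∀ {Δ ds} → (φ ⟶ ψ) ∷ Γ ↭ Δ → cs ⊆ ds → ¬ node Δ ds ⊩ φ) →
            Ensured ((φ ⟶ ψ) ∷ Γ) (_⊩ (φ ⟶ ψ))
ensured-⟶ {φ} {ψ} cs ss h = ensure cs ss λ Γ↭Δ ⊆ds ds →
  ⊩-⟶-root {φ = φ} {ψ} (⊥-elim ∘ h Γ↭Δ ⊆ds) (suitable-head ds)

-- Analysis of a single formula of a sequent

_∈?_ : ∀ p Γ → Dec (var p ∈ Γ)
p ∈? Γ = any? (isVar p) Γ
  where
  isVar : ∀ p φ → Dec (var p ≡ φ)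
  isVar p (var q) = map′ (cong var) (λ { refl → refl }) (p ≟ q)
  isVar p ⊥       = no λ ()
  isVar p (φ ∧ ψ) = no λ ()
  isVar p (φ ∨ ψ) = no λ ()
  isVar p (φ ⟶ ψ) = no λ ()
  isVar p (□ φ)   = no λ ()

-- Either a rule with `x` principal settles the sequent, by a proof or by a premise's countermodel,
-- or a new root can be made to force `x`.
leftStep : ∀ x Γ χ → (∀ S → S ≺ (x ∷ Γ ⇒ χ) → Decided S) →
           Decided (x ∷ Γ ⇒ χ) ⊎ Ensured (x ∷ Γ) (_⊩ x)
leftStep (var p) Γ χ IH = inj₂ (ensure [] [] λ where
  Γ↭Δ _ cs root          → ∈-resp-↭ Γ↭Δ (here refl)
  Γ↭Δ _ cs (below i c≼U) → All.lookup (suitable-head {φ = var p} cs) i c≼U)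
leftStep ⊥ Γ χ IH = inj₁ (inj₁ (infer ⊥L []))
leftStep (φ ∧ ψ) Γ χ IH
  with IH (φ ∷ ψ ∷ Γ ⇒ χ)
          (≺-left (φ ∧ ψ) (φ ∷ ψ ∷ []) (s≤s (s≤s z≤n))
            (lighter φ (s≤s (m≤n⇒m≤1+n (m≤m+n _ _))) ∷
             lighter ψ (s≤s (m≤n⇒m≤1+n (m≤n+m _ _))) ∷ []))
... | inj₁ d                    = inj₁ (inj₁ (infer ∧L (d ∷ [])))
... | inj₂ (T , f ∷ g ∷ fs , n) = inj₁ (inj₂ (T , (f , g) ∷ fs , n))
leftStep (φ ∨ ψ) Γ χ IH
  with IH (φ ∷ Γ ⇒ χ)
          (≺-left (φ ∨ ψ) (φ ∷ []) (s≤s z≤n) (lighter φ (s≤s (m≤m+n _ _)) ∷ []))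
     | IH (ψ ∷ Γ ⇒ χ)
          (≺-left (φ ∨ ψ) (ψ ∷ []) (s≤s z≤n) (lighter ψ (s≤s (m≤n+m _ _)) ∷ []))
... | inj₁ d | inj₁ e           = inj₁ (inj₁ (infer ∨L (d ∷ e ∷ [])))
... | inj₂ (T , f ∷ fs , n) | _ = inj₁ (inj₂ (T , inj₁ f ∷ fs , n))
... | _ | inj₂ (T , g ∷ fs , n) = inj₁ (inj₂ (T , inj₂ g ∷ fs , n))
-- A modal child forces the unboxed context, hence `φ`; any other path enters a child that forces
-- `□ φ` already.
leftStep (□ φ) Γ χ IH = inj₂ (ensure [] [] λ where
  Γ↭Δ _ cs (modal i c≼U) → ⊩-mono φ c≼U (All.head (All.lookup cs i))
  Γ↭Δ _ cs (below i c◁U) → All.lookup (suitable-head {φ = □ φ} cs) i c◁U)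
leftStep (var p ⟶ φ) Γ χ IH with p ∈? Γ
... | no p∉Γ = inj₂ (ensured-⟶ [] [] λ Γ↭Δ _ f →
  absurd (∈-resp-↭ (↭-sym Γ↭Δ) (f root)))
  where
  absurd : ¬ (var p ∈ (var p ⟶ φ) ∷ Γ)
  absurd (there p∈Γ) = p∉Γ p∈Γ
... | yes p∈Γ
  with Δ , Γ↭ ← ∈⇒↭ p∈Γ
  with IH (φ ∷ Γ ⇒ χ)
          (≺-left (var p ⟶ φ) (φ ∷ []) (s≤s z≤n) (lighter φ (s≤s (m≤n+m _ 1)) ∷ []))
... | inj₁ d = inj₁ (inj₁ (⊢-resp-↭ (↭-trans (swap _ _ ↭-refl) (prep _ (↭-sym Γ↭)))
                 (infer p→L (⊢-resp-↭ (↭-trans (prep _ Γ↭) (swap _ _ ↭-refl)) d ∷ []))))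
... | inj₂ (T , f ∷ fs , n) = inj₁ (inj₂ (T , ⊩-const (var p) f ∷ fs , n))
leftStep (⊥ ⟶ φ) Γ χ IH = inj₂ (ensured-⟶ [] [] λ _ _ f → f)
leftStep (φ ∧ ψ ⟶ θ) Γ χ IH
  with IH ((φ ⟶ (ψ ⟶ θ)) ∷ Γ ⇒ χ)
          (≺-left (φ ∧ ψ ⟶ θ) ((φ ⟶ (ψ ⟶ θ)) ∷ []) (s≤s z≤n)
            (≤-reflexive (cong (λ n → 2 + n)
              (trans (+-suc (weight φ) _) (cong suc (sym (+-assoc (weight φ) _ _))))) ∷ []))
... | inj₁ d = inj₁ (inj₁ (infer ∧→L (d ∷ [])))
... | inj₂ (T , f ∷ fs , n) =
  inj₁ (inj₂ (T , (λ T≼U (a , b) → f T≼U a root b) ∷ fs , n))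
leftStep (φ ∨ ψ ⟶ θ) Γ χ IH
  with IH ((φ ⟶ θ) ∷ (ψ ⟶ θ) ∷ Γ ⇒ χ)
          (≺-left (φ ∨ ψ ⟶ θ) ((φ ⟶ θ) ∷ (ψ ⟶ θ) ∷ []) (s≤s (s≤s z≤n))
            (s≤s (s≤s (+-monoˡ-≤ (weight θ) (m≤m+n _ _))) ∷
             s≤s (s≤s (+-monoˡ-≤ (weight θ) (m≤n+m _ _))) ∷ []))
... | inj₁ d = inj₁ (inj₁ (infer ∨→L (d ∷ [])))
... | inj₂ (T , f ∷ g ∷ fs , n) =
  inj₁ (inj₂ (T , (λ where T≼U (inj₁ a) → f T≼U a
                           T≼U (inj₂ b) → g T≼U b) ∷ fs , n))
leftStep ((φ ⟶ ψ) ⟶ θ) Γ χ IH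
  with IH (θ ∷ Γ ⇒ χ)
          (≺-left ((φ ⟶ ψ) ⟶ θ) (θ ∷ []) (s≤s z≤n) (lighter θ (s≤s (m≤n+m _ _)) ∷ []))
     -- The left premise is searched with →R already applied, so that a refutation yields a tree
     -- forcing `φ` but not `ψ`.
     | IH (φ ∷ (ψ ⟶ θ) ∷ Γ ⇒ ψ)
          (≺-both ((φ ⟶ ψ) ⟶ θ) (φ ∷ (ψ ⟶ θ) ∷ []) ≤-refl ≤-refl
            (s≤s (≤-trans (m≤n+m _ (suc (weight φ))) (m≤m+n _ (weight θ))))
            (lighter φ (s≤s (m≤n⇒m≤1+n (≤-trans (m≤m+n _ (weight ψ)) (m≤m+n _ _)))) ∷
             s≤s (s≤s (+-monoˡ-≤ (weight θ) (m≤n+m _ _))) ∷ []))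
... | inj₂ (T , f ∷ fs , n) | _ = inj₁ (inj₂ (T , ⊩-const (φ ⟶ ψ) f ∷ fs , n))
... | inj₁ e | inj₁ d = inj₁ (inj₁ (infer →→L (infer →R (d ∷ []) ∷ e ∷ [])))
... | inj₁ e | inj₂ (T , f ∷ g ∷ fs , n) = inj₂ (ensured-⟶
  ((plain , T) ∷ [])
  -- `φ` holds from `T` on, so there `φ ⟶ ψ` gives `ψ`, and `ψ ⟶ θ` gives `θ`.
  (((λ T≼U h → g T≼U (h root (⊩-mono φ T≼U f))) ∷ fs) ∷ [])
  λ _ ⊆cs h → n (h (below (⊆cs (here refl)) root) f))
leftStep (□ φ ⟶ ψ) Γ χ IH
  with IH (ψ ∷ Γ ⇒ χ)
          (≺-left (□ φ ⟶ ψ) (ψ ∷ []) (s≤s z≤n) (lighter ψ (s≤s (m≤n+m _ _)) ∷ []))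
     | IH (□ φ ∷ ψ ∷ unbox* Γ ⇒ φ)
          (≺-both (□ φ ⟶ ψ) (□ φ ∷ ψ ∷ []) ≤-refl (total-unbox (unbox* Γ))
            (s≤s (m≤n⇒m≤1+n (m≤m+n _ _)))
            (s≤s (m≤n⇒m≤1+n (m≤m+n _ _)) ∷ lighter ψ (s≤s (m≤n+m _ _)) ∷ []))
... | inj₂ (T , f ∷ fs , n) | _ = inj₁ (inj₂ (T , ⊩-const (□ φ) f ∷ fs , n))
... | inj₁ e | inj₁ d = inj₁ (inj₁ (□→L-unbox d e))
-- `T` refutes `φ` and forces the unboxed context, so grafting it by a modal edge falsifies `□ φ` at
-- the root.
... | inj₁ e | inj₂ (T , f ∷ g ∷ fs , n) = inj₂ (ensured-⟶
  ((modal , T) ∷ [])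
  ((⊩-const (□ φ) g ∷ fs) ∷ [])
  λ _ ⊆cs h → n (h (modal (⊆cs (here refl)) root)))

rightStep : ∀ Γ χ → (∀ S → S ≺ (Γ ⇒ χ) → Decided S) →
            Decided (Γ ⇒ χ) ⊎ Ensured Γ (λ T → ¬ T ⊩ χ)
rightStep Γ (var p) IH with p ∈? Γ
... | yes p∈Γ = inj₁ (inj₁ (⊢-resp-↭ (↭-sym (proj₂ (∈⇒↭ p∈Γ))) (infer IdP [])))
... | no p∉Γ  = inj₂ (ensure [] [] λ Γ↭Δ _ _ f → p∉Γ (∈-resp-↭ (↭-sym Γ↭Δ) (f root)))
rightStep Γ ⊥ IH = inj₂ (ensure [] [] λ _ _ _ f → f)
rightStep Γ (φ ∧ ψ) IH
  with IH (Γ ⇒ φ) (≺-right (φ ∧ ψ) [] z≤n ≤-refl (s≤s (m≤n⇒m≤1+n (m≤m+n _ _))) [])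
     | IH (Γ ⇒ ψ) (≺-right (φ ∧ ψ) [] z≤n ≤-refl (s≤s (m≤n⇒m≤1+n (m≤n+m _ _))) [])
... | inj₁ d | inj₁ e       = inj₁ (inj₁ (infer ∧R (d ∷ e ∷ [])))
... | inj₂ (T , fs , n) | _ = inj₁ (inj₂ (T , fs , n ∘ proj₁))
... | _ | inj₂ (T , fs , n) = inj₁ (inj₂ (T , fs , n ∘ proj₂))
rightStep Γ (φ ∨ ψ) IH
  with IH (Γ ⇒ φ) (≺-right (φ ∨ ψ) [] z≤n ≤-refl (s≤s (m≤m+n _ _)) [])
     | IH (Γ ⇒ ψ) (≺-right (φ ∨ ψ) [] z≤n ≤-refl (s≤s (m≤n+m _ _)) [])
... | inj₁ d | _ = inj₁ (inj₁ (infer ∨R₁ (d ∷ [])))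
... | _ | inj₁ e = inj₁ (inj₁ (infer ∨R₂ (e ∷ [])))
... | inj₂ (T , fs , n) | inj₂ (U , gs , m) =
  -- Each child refutes one disjunct, so by persistence the root forces neither.
  inj₂ (ensure ((plain , T) ∷ (plain , U) ∷ []) (fs ∷ gs ∷ []) λ where
    _ ⊆cs _ (inj₁ f) → n (⊩-mono φ (below (⊆cs (here refl)) root) f)
    _ ⊆cs _ (inj₂ g) → m (⊩-mono ψ (below (⊆cs (there (here refl))) root) g))
rightStep Γ (φ ⟶ ψ) IH
  with IH (φ ∷ Γ ⇒ ψ)
          (≺-right (φ ⟶ ψ) (φ ∷ []) (s≤s z≤n) ≤-refl (s≤s (m≤n+m _ _))
            (lighter φ (s≤s (m≤m+n _ _)) ∷ []))
... | inj₁ d                = inj₁ (inj₁ (infer →R (d ∷ [])))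
... | inj₂ (T , f ∷ fs , n) = inj₁ (inj₂ (T , fs , λ h → n (h root f)))
rightStep Γ (□ φ) IH
  with IH (□ φ ∷ unbox* Γ ⇒ φ)
          (≺-right (□ φ) (□ φ ∷ []) (s≤s z≤n) (total-unbox (unbox* Γ)) ≤-refl
            (≤-refl ∷ []))
... | inj₁ d                = inj₁ (inj₁ (SLtR-unbox d))
... | inj₂ (T , f ∷ fs , n) = inj₂ (ensure ((modal , T) ∷ []) (fs ∷ [])
  λ _ ⊆cs _ h → n (h (modal (⊆cs (here refl)) root)))

-- Deciding every sequent, and cut elimination

decided-resp-↭ : ∀ {Γ Δ χ} → Γ ↭ Δ → Decided (Γ ⇒ χ) → Decided (Δ ⇒ χ)
decided-resp-↭ Γ↭Δ (inj₁ d)            = inj₁ (⊢-resp-↭ Γ↭Δ d)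
decided-resp-↭ Γ↭Δ (inj₂ (T , fs , n)) = inj₂ (T , All-resp-↭ Γ↭Δ fs , n)

≺-resp-↭ : ∀ {S Γ Δ χ} → Γ ↭ Δ → S ≺ (Γ ⇒ χ) → S ≺ (Δ ⇒ χ)
≺-resp-↭ {S} {χ = χ} Γ↭Δ (mk≺ lt) =
  mk≺ (subst (measure S <_) (cong (_+ cost χ) (sum-↭ (map⁺ cost (map⁺ unbox Γ↭Δ)))) lt)

all-or : ∀ {A : Set} {P : Formula → Set} Γ → (∀ {φ} → φ ∈ Γ → A ⊎ P φ) → A ⊎ All P Γ
all-or []      f = inj₂ []
all-or (φ ∷ Γ) f with f (here refl) | all-or Γ (f ∘ there)
... | inj₁ a | _       = inj₁ a
... | _      | inj₁ a  = inj₁ a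
... | inj₂ p | inj₂ ps = inj₂ (p ∷ ps)

-- If no formula on either side settles the sequent, all the collected requirements are met by one
-- root labelled `Γ`.
decideStep : ∀ S → (∀ {S′} → S′ ≺ S → Decided S′) → Decided S
decideStep (Γ ⇒ χ) IH with rightStep Γ χ (λ _ → IH)
... | inj₁ d  = d
... | inj₂ e′ with all-or Γ left
  where
  left : ∀ {φ} → φ ∈ Γ → Decided (Γ ⇒ χ) ⊎ Ensured Γ (_⊩ φ)
  left {φ} φ∈Γ with Δ , Γ↭ ← ∈⇒↭ φ∈Γ
    with leftStep φ Δ χ (λ _ → IH ∘ ≺-resp-↭ (↭-sym Γ↭))
  ... | inj₁ d = inj₁ (decided-resp-↭ (↭-sym Γ↭) d)
  ... | inj₂ e = inj₂ (ensured-resp-↭ (↭-sym Γ↭) e)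
... | inj₁ d  = d
... | inj₂ es = inj₂ (ensured⇒refuted (ensured-⊩* es) e′)

decide : ∀ S → Decided S
decide = wfRec Decided decideStep
  where open WF.All ≺-wellFounded 0ℓ

theorem3 : ∀ (S : Sequent) → G4iSLt+cut ⊢ S → G4iSLt ⊢ S
theorem3 S d with decide S
... | inj₁ e            = e
... | inj₂ (T , fs , n) = ⊥-elim (n (soundness d fs))
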